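{- Let $(a_k)_{k\ge1}$ be a sequence of positive integers. If there exists an integer $m\ge0$ such that the infinite word $a_{m+1}a_{m+2}\ldots$ is recurrent, then the real number $\alpha:=[0;a_1,a_2,\ldots]$ satisfies $$\lim_{n\to+\infty}c(n\alpha)=0$$ and, moreover, $$c(n\alpha)\le\frac{8q_m^2}{n},\qquad\text{for every integer } n\ge1,$$ where $q_m$ denotes the denominator of the rational number $[0;a_1,\ldots,a_m]$.
   Context: $\Vert x\Vert$ denotes the distance from the real number $x$ to the nearest integer. $[0;a_1,a_2,\ldots]$ denotes the continued fraction with partial quotients $a_1,a_2,\ldots$; $q_m$ is the denominator in lowest terms of $[0;a_1,\ldots,a_m]$, with $q_0=1$. An infinite word is recurrent if every finite block (of consecutive letters) occurring in it occurs infinitely often. The Lagrange constant of an irrational real number $\beta$ is $c(\beta):=\liminf_{q\to+\infty}q\cdot\Vert q\beta\Vert$ ($q$ ranging over positive integers). -}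

module Defs where

open import Data.Nat.Base as ℕ using (ℕ; zero; suc)
import Data.Nat.Properties as ℕ
open import Data.Integer.Base as ℤ using (ℤ; +_; +[1+_]; -[1+_])
import Data.Integer.Properties as ℤ
import Data.Integer.DivMod as ℤ
import Data.Integer.Solver as ℤSolver
import Data.Rational.Unnormalised.Base as ℚᵘ
import Data.Rational.Unnormalised.Properties as ℚᵘ
open import Data.Rational.Base
open import Data.Rational.Properties
open import Data.Rational.Solver using (module +-*-Solver)
open import Data.Fin.Base using (Fin; toℕ)
open import Data.Vec.Base using (Vec; lookup)
open import Data.Product.Base using (∃-syntax; _×_; _,_; proj₁; proj₂)
open import Data.Sum.Base using (inj₁; inj₂)
open import Relation.Binary.PropositionalEquality
open import Relation.Nullary.Decidable.Core using (yes; no)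

private
  variable
    p q r s x y : ℚ

------------------------------------------------------------------------
-- Infinite words, indexed from 0

OccursAt : {A : Set} {l : ℕ} → Vec A l → (ℕ → A) → ℕ → Set
OccursAt b w i = ∀ k → w (i ℕ.+ toℕ k) ≡ lookup b k

-- "Infinitely often" is the positive ∀N∃j≥N rather than the double
-- negation of Data.Nat.InfinitelyOften; the two agree classically.

Recurrent : {A : Set} → (ℕ → A) → Set
Recurrent {A} w = ∀ {l} (b : Vec A l) i → OccursAt b w i →
                  ∀ N → ∃[ j ] N ℕ.≤ j × OccursAt b w j

fromℕ : ℕ → ℚ
fromℕ n = + n / 1

private
  module S = +-*-Solver

1ℕ≤ : ∀ n .{{_ : ℕ.NonZero n}} → 1 ℕ.≤ n
1ℕ≤ (suc n) = ℕ.s≤s ℕ.z≤n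

/1-mono : ∀ {i j} → i ℤ.≤ j → i / 1 ≤ j / 1
/1-mono {i} {j} i≤j = toℚᵘ-cancel-≤ (ℚᵘ.≤-respˡ-≃ (ℚᵘ.≃-sym (toℚᵘ-fromℚᵘ (ℚᵘ.mkℚᵘ i 0)))
  (ℚᵘ.≤-respʳ-≃ (ℚᵘ.≃-sym (toℚᵘ-fromℚᵘ (ℚᵘ.mkℚᵘ j 0))) (ℚᵘ.*≤* (ℤ.*-monoʳ-≤-nonNeg (+ 1) i≤j))))

suc-/1 : ∀ i → (ℤ.suc i) / 1 ≡ 1ℚ + i / 1
suc-/1 i = toℚᵘ-injective (begin
  toℚᵘ (ℤ.suc i / 1)                  ≈⟨ toℚᵘ-fromℚᵘ (ℚᵘ.mkℚᵘ (ℤ.suc i) 0) ⟩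
  ℚᵘ.mkℚᵘ (ℤ.suc i) 0                 ≈⟨ ℚᵘ.*≡* (ℤS.solve 1 (λ i →
    (ℤS.con (+ 1) ℤS.:+ i) ℤS.:* ℤS.con (+ 1)
      ℤS.:= (ℤS.con (+ 1) ℤS.:* ℤS.con (+ 1) ℤS.:+ i ℤS.:* ℤS.con (+ 1)) ℤS.:* ℤS.con (+ 1)) refl i) ⟩
  ℚᵘ.1ℚᵘ ℚᵘ.+ ℚᵘ.mkℚᵘ i 0             ≈⟨ ℚᵘ.+-congʳ ℚᵘ.1ℚᵘ (toℚᵘ-fromℚᵘ (ℚᵘ.mkℚᵘ i 0)) ⟨
  ℚᵘ.1ℚᵘ ℚᵘ.+ toℚᵘ (i / 1)            ≈⟨ toℚᵘ-homo-+ 1ℚ (i / 1) ⟨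
  toℚᵘ (1ℚ + i / 1)                   ∎)
  where open ℚᵘ.≃-Reasoning
        module ℤS = ℤSolver.+-*-Solver

fromℕ-suc : ∀ n → fromℕ (suc n) ≡ 1ℚ + fromℕ n
fromℕ-suc n = suc-/1 (+ n)

fromℕ-nonNeg : ∀ n → NonNegative (fromℕ n)
fromℕ-nonNeg n = normalize-nonNeg n 1

fromℕ-pos : ∀ n → .{{ℕ.NonZero n}} → Positive (fromℕ n)
fromℕ-pos n = normalize-pos n 1

1≤fromℕ : ∀ n → .{{ℕ.NonZero n}} → 1ℚ ≤ fromℕ n
1≤fromℕ n = /1-mono (ℤ.+≤+ (1ℕ≤ n))

archimedean : ∀ {ε} → 0ℚ < ε → ∃[ N ] 1ℚ < fromℕ N * ε
archimedean {mkℚ (+ zero) d c} (*<* (ℤ.+<+ ()))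
archimedean {mkℚ -[1+ n ] d c} (*<* ())
archimedean {ε@(mkℚ +[1+ n ] d c)} 0<ε = suc (suc d) , toℚᵘ-cancel-<
  (ℚᵘ.<-respʳ-≃ (ℚᵘ.≃-sym
    (ℚᵘ.≃-trans (toℚᵘ-homo-* (fromℕ (suc (suc d))) ε)
                (ℚᵘ.*-congʳ {toℚᵘ ε} (toℚᵘ-fromℚᵘ (ℚᵘ.mkℚᵘ (+ suc (suc d)) 0)))))
    (ℚᵘ.*<* (ℤ.+<+ lt)))
  where
  lt : 1 ℕ.* suc (d ℕ.+ 0) ℕ.< suc (suc d) ℕ.* suc n ℕ.* 1
  lt = ℕ.≤-trans
    (ℕ.s≤s (ℕ.≤-reflexive (trans (ℕ.*-identityˡ _) (cong suc (ℕ.+-identityʳ d)))))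
    (ℕ.≤-trans (ℕ.m≤m*n (suc (suc d)) (suc n)) (ℕ.≤-reflexive (sym (ℕ.*-identityʳ _))))

∣∣< : p < q → - p < q → ∣ p ∣ < q
∣∣< {p} {q} h₁ h₂ with ∣p∣≡p∨∣p∣≡-p p
... | inj₁ e = subst (_< q) (sym e) h₁
... | inj₂ e = subst (_< q) (sym e) h₂

∣∣≤ : p ≤ q → - p ≤ q → ∣ p ∣ ≤ q
∣∣≤ {p} {q} h₁ h₂ with ∣p∣≡p∨∣p∣≡-p p
... | inj₁ e = subst (_≤ q) (sym e) h₁
... | inj₂ e = subst (_≤ q) (sym e) h₂

≤∣∣ : ∀ p → p ≤ ∣ p ∣
≤∣∣ p with ≤-total 0ℚ p
... | inj₁ 0≤p = ≤-reflexive (sym (0≤p⇒∣p∣≡p 0≤p))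
... | inj₂ p≤0 = ≤-trans p≤0 (0≤∣p∣ p)

swap-minus : ∀ p q → - (p - q) ≡ q - p
swap-minus = S.solve 2 (λ p q → S.:- (p S.:- q) S.:= (q S.:- p)) refl

0≤minus : p ≤ q → 0ℚ ≤ q - p
0≤minus {p} {q} p≤q = subst (_≤ q - p) (+-inverseʳ p) (+-monoˡ-≤ (- p) p≤q)

∣-∣-comm : ∀ p q → ∣ p - q ∣ ≡ ∣ q - p ∣
∣-∣-comm p q = trans (sym (∣-p∣≡∣p∣ (p - q))) (cong ∣_∣ (swap-minus p q))

------------------------------------------------------------------------
-- Real numbers, as Cauchy sequences of rationals

record ℝ : Set where
  field
    seq    : ℕ → ℚ
    cauchy : ∀ ε → 0ℚ < ε →
             ∃[ N ] (∀ m n → N ℕ.≤ m → N ℕ.≤ n → ∣ seq m - seq n ∣ < ε)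

open ℝ public

extend : (f : ℚ → ℚ) (K : ℚ) .{{_ : Positive K}} →
         (∀ x y → ∣ f x - f y ∣ ≤ K * ∣ x - y ∣) → ℝ → ℝ
extend f K lip x .seq k = f (seq x k)
extend f K lip x .cauchy ε 0<ε = N , λ m n N≤m N≤n → begin-strict
    ∣ f (seq x m) - f (seq x n) ∣  ≤⟨ lip _ _ ⟩
    K * ∣ seq x m - seq x n ∣      <⟨ *-monoʳ-<-pos K (bound m n N≤m N≤n) ⟩
    K * (1/ K * ε)                 ≡⟨ *-assoc K (1/ K) ε ⟨
    K * 1/ K * ε                   ≡⟨ cong (_* ε) (*-inverseʳ K) ⟩
    1ℚ * ε                         ≡⟨ *-identityˡ ε ⟩
    ε                              ∎
  where
  open ≤-Reasoning
  instance
    K≢0 : NonZero K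
    K≢0 = pos⇒nonZero K
  δ-pos : Positive (1/ K * ε)
  δ-pos = pos*pos⇒pos (1/ K) {{1/pos⇒pos K}} ε {{positive 0<ε}}
  c = cauchy x (1/ K * ε) (positive⁻¹ (1/ K * ε) {{δ-pos}})
  N = c .proj₁
  bound = c .proj₂

infixr 8 _·_

_·_ : ℕ → ℝ → ℝ
n · x = extend (fromℕ n *_) (fromℕ (suc n)) {{fromℕ-pos (suc n)}} lip x
  where
  open ≤-Reasoning
  lip : ∀ x y → ∣ fromℕ n * x - fromℕ n * y ∣ ≤ fromℕ (suc n) * ∣ x - y ∣
  lip x y = begin
    ∣ fromℕ n * x - fromℕ n * y ∣
      ≡⟨ cong ∣_∣ (S.solve 3 (λ k x y → k S.:* x S.:- k S.:* y S.:= k S.:* (x S.:- y)) refl (fromℕ n) x y) ⟩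
    ∣ fromℕ n * (x - y) ∣          ≡⟨ ∣p*q∣≡∣p∣*∣q∣ (fromℕ n) (x - y) ⟩
    ∣ fromℕ n ∣ * ∣ x - y ∣        ≡⟨ cong (_* ∣ x - y ∣)
                                       (0≤p⇒∣p∣≡p (nonNegative⁻¹ (fromℕ n) {{fromℕ-nonNeg n}})) ⟩
    fromℕ n * ∣ x - y ∣            ≤⟨ *-monoʳ-≤-nonNeg ∣ x - y ∣ {{∣-∣-nonNeg (x - y)}}
                                       (/1-mono {+ n} {+ suc n} (ℤ.+≤+ (ℕ.n≤1+n n))) ⟩
    fromℕ (suc n) * ∣ x - y ∣      ∎

-- Distance to the nearest integer: the minimum of ∣ x - i ∣ over i : ℤ, by
-- ‖‖-attained and ‖‖-least.  It is 1-Lipschitz, hence extends to ℝ.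

‖_‖ℚ : ℚ → ℚ
‖ x ‖ℚ = (x - floor x / 1) ⊓ (ℤ.suc (floor x) / 1 - x)

floor≤ : ∀ x → floor x / 1 ≤ x
floor≤ x@record{} = toℚᵘ-cancel-≤
  (ℚᵘ.≤-respˡ-≃ (ℚᵘ.≃-sym (toℚᵘ-fromℚᵘ (ℚᵘ.mkℚᵘ (floor x) 0)))
    (ℚᵘ.*≤* (subst (floor x ℤ.* ↧ x ℤ.≤_) (sym (ℤ.*-identityʳ (↥ x))) (ℤ.[n/d]*d≤n (↥ x) (↧ x)))))

<suc-floor : ∀ x → x < ℤ.suc (floor x) / 1
<suc-floor x@record{} = toℚᵘ-cancel-<
  (ℚᵘ.<-respʳ-≃ (ℚᵘ.≃-sym (toℚᵘ-fromℚᵘ (ℚᵘ.mkℚᵘ (ℤ.suc (floor x)) 0)))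
    (ℚᵘ.*<* (subst₂ ℤ._<_ (sym (ℤ.*-identityʳ (↥ x)))
      (cong (λ i → ℤ.suc i ℤ.* ↧ x) (sym (ℤ.div-pos-is-/ℕ (↥ x) (↧ₙ x))))
      (ℤ.n<s[n/ℕd]*d (↥ x) (↧ₙ x)))))

‖‖-attained : ∀ x → ∃[ i ] ‖ x ‖ℚ ≡ ∣ x - i / 1 ∣
‖‖-attained x with ≤-total (x - floor x / 1) (ℤ.suc (floor x) / 1 - x)
... | inj₁ h = floor x , trans (p≤q⇒p⊓q≡p h)
      (sym (0≤p⇒∣p∣≡p (0≤minus (floor≤ x))))
... | inj₂ h = ℤ.suc (floor x) , trans (p≥q⇒p⊓q≡q h)
      (trans (sym (0≤p⇒∣p∣≡p (0≤minus (<⇒≤ (<suc-floor x))))) (∣-∣-comm _ x))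

‖‖-least : ∀ x i → ‖ x ‖ℚ ≤ ∣ x - i / 1 ∣
‖‖-least x i with i ℤ.≤? floor x
... | yes i≤f = ≤-trans (p⊓q≤p (x - floor x / 1) (ℤ.suc (floor x) / 1 - x))
      (≤-trans (+-monoʳ-≤ x (neg-antimono-≤ (/1-mono i≤f))) (≤∣∣ (x - i / 1)))
... | no  i≰f = ≤-trans (p⊓q≤q (x - floor x / 1) (ℤ.suc (floor x) / 1 - x))
      (≤-trans (+-monoˡ-≤ (- x) (/1-mono (ℤ.i<j⇒suc[i]≤j (ℤ.≰⇒> i≰f))))
        (≤-trans (≤∣∣ (i / 1 - x)) (≤-reflexive (∣-∣-comm (i / 1) x))))

‖‖-sub : ∀ x y → ‖ x ‖ℚ - ‖ y ‖ℚ ≤ ∣ x - y ∣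
‖‖-sub x y with ‖‖-attained y
... | i , e = begin
    ‖ x ‖ℚ - ‖ y ‖ℚ                        ≤⟨ +-monoˡ-≤ (- ‖ y ‖ℚ) (‖‖-least x i) ⟩
    ∣ x - j ∣ - ‖ y ‖ℚ                     ≡⟨ cong (λ t → ∣ t ∣ - ‖ y ‖ℚ)
      (S.solve 3 (λ x y j → x S.:- j S.:= (x S.:- y) S.:+ (y S.:- j)) refl x y j) ⟩
    ∣ (x - y) + (y - j) ∣ - ‖ y ‖ℚ         ≤⟨ +-monoˡ-≤ (- ‖ y ‖ℚ) (∣p+q∣≤∣p∣+∣q∣ (x - y) (y - j)) ⟩
    ∣ x - y ∣ + ∣ y - j ∣ - ‖ y ‖ℚ         ≡⟨ cong (λ t → ∣ x - y ∣ + ∣ y - j ∣ - t) e ⟩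
    ∣ x - y ∣ + ∣ y - j ∣ - ∣ y - j ∣      ≡⟨ S.solve 2 (λ s t → (s S.:+ t) S.:- t S.:= s)
                                                refl ∣ x - y ∣ ∣ y - j ∣ ⟩
    ∣ x - y ∣                              ∎
  where open ≤-Reasoning
        j = i / 1

‖_‖ : ℝ → ℝ
‖_‖ = extend ‖_‖ℚ 1ℚ λ x y → ≤-trans
  (∣∣≤ (‖‖-sub x y)
       (subst₂ _≤_ (sym (swap-minus ‖ x ‖ℚ ‖ y ‖ℚ)) (∣-∣-comm y x) (‖‖-sub y x)))
  (≤-reflexive (sym (*-identityˡ ∣ x - y ∣)))

------------------------------------------------------------------------
-- Extended upper reals
--
-- A lower limit of Cauchy reals need not be a Cauchy real constructively,
-- so liminf takes values in upper Dedekind cuts: Above u r means u < r.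
-- Classically these cuts are exactly the elements of [-∞, +∞], with +∞
-- the empty cut and -∞ the full one.

record ℝᵘ : Set₁ where
  field
    Above   : ℚ → Set
    upward  : r < s → Above r → Above s
    rounded : Above s → ∃[ r ] r < s × Above r

open ℝᵘ public

infix 4 _≤ᵘ_

_≤ᵘ_ : ℝᵘ → ℝᵘ → Set
u ≤ᵘ v = ∀ {r} → Above v r → Above u r

fromℚ : ℚ → ℝᵘ
fromℚ q .Above r = q < r
fromℚ q .upward r<s q<r = <-trans q<r r<s
fromℚ q .rounded q<s with <-dense q<s
... | r , q<r , r<s = r , r<s , q<r

fromℝ : ℝ → ℝᵘ
fromℝ x .Above r = ∃[ s ] s < r × ∃[ N ] (∀ k → N ℕ.≤ k → seq x k ≤ s)
fromℝ x .upward r<s (t , t<r , h) = t , <-trans t<r r<s , h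
fromℝ x .rounded (t , t<s , h) with <-dense t<s
... | r , t<r , r<s = r , r<s , t , t<r , h

inf : {I : Set} → (I → ℝᵘ) → ℝᵘ
inf u .Above r = ∃[ i ] Above (u i) r
inf u .upward r<s (i , h) = i , upward (u i) r<s h
inf u .rounded (i , h) with rounded (u i) h
... | r , r<s , h′ = r , r<s , i , h′

sup : {I : Set} → (I → ℝᵘ) → ℝᵘ
sup u .Above r = ∃[ s ] s < r × (∀ i → Above (u i) s)
sup u .upward r<s (t , t<r , h) = t , <-trans t<r r<s , h
sup u .rounded (t , t<s , h) with <-dense t<s
... | r , t<r , r<s = r , r<s , t , t<r , h

liminf : (ℕ → ℝ) → ℝᵘ
liminf x = sup λ N → inf λ k → fromℝ (x (N ℕ.+ k))

infix 4 _⟶_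

_⟶_ : (ℕ → ℝᵘ) → ℚ → Set
u ⟶ L = ∀ ε → 0ℚ < ε → ∃[ N ] (∀ n → N ℕ.≤ n →
  fromℚ (L - ε) ≤ᵘ u n × u n ≤ᵘ fromℚ (L + ε))

-- liminf of q ‖q β‖ over the positive integers q = k + 1.  It makes sense
-- for rational β too, where it is 0.

lagrangeConstant : ℝ → ℝᵘ
lagrangeConstant β = liminf λ k → suc k · ‖ suc k · β ‖

------------------------------------------------------------------------
-- Continued fractions [0; a₁, a₂, …].  A sequence a : ℕ → ℕ is indexed
-- from 0, so that the partial quotient aₖ₊₁ is a k.

convergent : (a : ℕ → ℕ) .{{_ : ∀ {k} → ℕ.NonZero (a k)}} → ℕ → ℚ
convergent-nonNeg : (a : ℕ → ℕ) .{{_ : ∀ {k} → ℕ.NonZero (a k)}} → ∀ m → NonNegative (convergent a m)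
denominator-pos : (a : ℕ → ℕ) .{{_ : ∀ {k} → ℕ.NonZero (a k)}} → ∀ m →
                  Positive (fromℕ (a 0) + convergent (λ k → a (suc k)) m)

-- [0; a₁, …, aₘ₊₁] = 1 / (a₁ + [0; a₂, …, aₘ₊₁])
convergent a zero    = 0ℚ
convergent a (suc m) =
  (1/ (fromℕ (a 0) + convergent (λ k → a (suc k)) m)) {{pos⇒nonZero (fromℕ (a 0) + convergent (λ k → a (suc k)) m) {{denominator-pos a m}}}}

convergent-nonNeg a zero    = _
convergent-nonNeg a (suc m) = pos⇒nonNeg (convergent a (suc m))
  {{1/pos⇒pos (fromℕ (a 0) + convergent (λ k → a (suc k)) m) {{denominator-pos a m}}}}

denominator-pos a m = pos+nonNeg⇒pos (fromℕ (a 0)) {{fromℕ-pos (a 0)}}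
  (convergent (λ k → a (suc k)) m) {{convergent-nonNeg (λ k → a (suc k)) m}}

contract : ∀ K u v .{{_ : NonNegative K}} .{{_ : Positive u}} .{{_ : Positive v}} →
  1ℚ ≤ u → 1ℚ ≤ v → K * (v - u) ≤ 1ℚ →
  (1ℚ + K) * ((1/ u) {{pos⇒nonZero u}} - (1/ v) {{pos⇒nonZero v}}) ≤ 1ℚ
contract K u v 1≤u 1≤v h = begin
  (1ℚ + K) * (i - j)
    ≡⟨ cong₂ (λ s t → (1ℚ + K) * (s - t))
         (trans (sym (*-identityʳ i)) (cong (i *_) (sym (*-inverseˡ v))))
         (trans (sym (*-identityʳ j)) (cong (j *_) (sym (*-inverseˡ u)))) ⟩
  (1ℚ + K) * (i * (j * v) - j * (i * u))
    ≡⟨ S.solve 5 (λ K u v i j → (S.con 1ℚ S.:+ K) S.:* (i S.:* (j S.:* v) S.:- j S.:* (i S.:* u))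
         S.:= (K S.:* (v S.:- u) S.:+ (v S.:- u)) S.:* (i S.:* j)) refl K u v i j ⟩
  (K * (v - u) + (v - u)) * (i * j)
    ≤⟨ *-monoʳ-≤-nonNeg (i * j) {{ij≥0}} (+-monoˡ-≤ (v - u) (≤-trans h 1≤u)) ⟩
  (u + (v - u)) * (i * j)
    ≡⟨ cong (_* (i * j)) (S.solve 2 (λ u v → u S.:+ (v S.:- u) S.:= S.con 1ℚ S.:* v) refl u v) ⟩
  (1ℚ * v) * (i * j)
    ≤⟨ *-monoʳ-≤-nonNeg (i * j) {{ij≥0}} (*-monoʳ-≤-nonNeg v {{pos⇒nonNeg v}} 1≤u) ⟩
  (u * v) * (i * j)
    ≡⟨ S.solve 4 (λ u v i j → (u S.:* v) S.:* (i S.:* j) S.:= (i S.:* u) S.:* (j S.:* v)) refl u v i j ⟩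
  (i * u) * (j * v)
    ≡⟨ cong₂ _*_ (*-inverseˡ u) (*-inverseˡ v) ⟩
  1ℚ ∎
  where
  open ≤-Reasoning
  instance
    u≢0 : NonZero u
    u≢0 = pos⇒nonZero u
    v≢0 : NonZero v
    v≢0 = pos⇒nonZero v
  i = 1/ u
  j = 1/ v
  ij≥0 : NonNegative (i * j)
  ij≥0 = pos⇒nonNeg (i * j) {{pos*pos⇒pos i {{1/pos⇒pos u}} j {{1/pos⇒pos v}}}}

1≤denominator : (a : ℕ → ℕ) .{{_ : ∀ {k} → ℕ.NonZero (a k)}} → ∀ m →
                1ℚ ≤ fromℕ (a 0) + convergent (λ k → a (suc k)) m
1≤denominator a m = subst (_≤ fromℕ (a 0) + convergent (λ k → a (suc k)) m) (+-identityʳ 1ℚ)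
  (+-mono-≤ (1≤fromℕ (a 0)) (nonNegative⁻¹ (convergent (λ k → a (suc k)) m) {{convergent-nonNeg (λ k → a (suc k)) m}}))

convergent-close : (a : ℕ → ℕ) .{{_ : ∀ {k} → ℕ.NonZero (a k)}} → ∀ K m n →
  K ℕ.≤ m → K ℕ.≤ n → fromℕ K * (convergent a m - convergent a n) ≤ 1ℚ
convergent-close a zero m n _ _ =
  subst (_≤ 1ℚ) (sym (*-zeroˡ (convergent a m - convergent a n))) (nonNegative⁻¹ 1ℚ)
convergent-close a (suc K) (suc m) (suc n) (ℕ.s≤s K≤m) (ℕ.s≤s K≤n) =
  subst (λ t → t * (convergent a (suc m) - convergent a (suc n)) ≤ 1ℚ) (sym (fromℕ-suc K))
    (contract (fromℕ K) (fromℕ (a 0) + convergent (λ k → a (suc k)) m)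
      (fromℕ (a 0) + convergent (λ k → a (suc k)) n) {{fromℕ-nonNeg K}} {{denominator-pos a m}} {{denominator-pos a n}}
      (1≤denominator a m) (1≤denominator a n)
      (subst (λ t → fromℕ K * t ≤ 1ℚ)
        (S.solve 3 (λ c s t → s S.:- t S.:= (c S.:+ s) S.:- (c S.:+ t)) refl
          (fromℕ (a 0)) (convergent (λ k → a (suc k)) n) (convergent (λ k → a (suc k)) m))
        (convergent-close (λ k → a (suc k)) K n m K≤n K≤m)))

-- [0; a₁, a₂, …] is the limit of its convergents, hence represented by
-- their sequence.

continuedFraction : (a : ℕ → ℕ) .{{_ : ∀ {k} → ℕ.NonZero (a k)}} → ℝ
continuedFraction a .seq = convergent a
continuedFraction a .cauchy ε 0<ε with archimedean 0<ε
... | N , 1<Nε = N , λ m n N≤m N≤n → ∣∣< (close m n N≤m N≤n)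
      (subst (_< ε) (sym (swap-minus (convergent a m) (convergent a n))) (close n m N≤n N≤m))
  where
  close : ∀ m n → N ℕ.≤ m → N ℕ.≤ n → convergent a m - convergent a n < ε
  close m n N≤m N≤n = *-cancelˡ-<-nonNeg (fromℕ N) {{fromℕ-nonNeg N}}
    (≤-<-trans (convergent-close a N m n N≤m N≤n) 1<Nε)

convergentDenominator : (a : ℕ → ℕ) .{{_ : ∀ {k} → ℕ.NonZero (a k)}} → ℕ → ℕ
convergentDenominator a m = ↧ₙ (convergent a m)

{-# OPTIONS --safe #-}
module Submission where

-- Write Mₖ for the matrix of the convergents pₖ₋₁/qₖ₋₁ and pₖ/qₖ, and
-- w = aₘ₊₁aₘ₊₂….  By recurrence w has prefixes U₀, U₁, … each of which ends
-- with the previous one, so by the pigeonhole principle two of them have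
-- the same matrix modulo n.  The longer one is Y followed by the shorter
-- one, hence the matrix of the prefix Y of w is the identity modulo n.  With
-- l = m + ∣Y∣ this gives (qₗ₋₁, qₗ) ≡ (qₘ₋₁, qₘ), so n divides
-- Q = qₘ₋₁qₗ - qₘqₗ₋₁.  Since ∣Q∣ ≤ qₘqₗ and ‖Qα‖ ≤ 2qₘ/qₗ, the multiplier
-- s = ∣Q∣/n satisfies s‖snα‖ ≤ 2qₘ²/n, and ∣Q∣ is large when Y is long.

open import Defs
open import Data.Nat.Base as ℕ
  using (ℕ; zero; suc; _+_; _*_; _^_; _%_; _⊔_; _≤_; _<_; z≤n; s≤s; NonZero)
open import Data.Nat.Properties
open import Data.Nat.DivMod using (_mod_; m%n<n; m≡m%n+[m/n]*n)
import Data.Nat.Divisibility as ℕ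
import Data.Nat.Tactic.RingSolver as ℕ
open import Data.Integer.Base as ℤ using (ℤ; +_)
import Data.Integer.Properties as ℤ
import Data.Integer.Divisibility.Signed as ℤ
import Data.Integer.Tactic.RingSolver as ℤ
open import Data.Rational.Base as ℚ using (0ℚ; _/_)
import Data.Rational.Properties as ℚ
import Data.Rational.Unnormalised.Base as ℚᵘ
import Data.Rational.Unnormalised.Properties as ℚᵘ
open import Data.Rational.Solver using (module +-*-Solver)
open import Data.Fin.Base using (Fin; toℕ; fromℕ<; combine)
open import Data.Fin.Properties using (toℕ-fromℕ<; pigeonhole; combine-injective)
open import Data.Vec.Base using (tabulate)
open import Data.Vec.Properties using (lookup∘tabulate)
open import Data.Product.Base using (_×_; _,_; proj₁; proj₂; ∃-syntax; ∃₂)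
open import Data.Sum.Base using (_⊎_; inj₁; inj₂)
open import Relation.Binary.Definitions using (tri<; tri≈; tri>)
open import Relation.Binary.PropositionalEquality

private
  module S = +-*-Solver

-- Matrices of convergents

record Mat : Set where
  constructor mat
  field p⁻ p q⁻ q : ℕ

open Mat

I : Mat
I = mat 1 0 0 1

infixl 7 _⊗_

_⊗_ : Mat → Mat → Mat
mat x y z w ⊗ mat x′ y′ z′ w′ =
  mat (x * x′ + y * z′) (x * y′ + y * w′) (z * x′ + w * z′) (z * y′ + w * w′)

-- Right multiplication by (0 1; 1 c).
step : ℕ → Mat → Mat
step c (mat x y z w) = mat y (x + y * c) w (z + w * c)

-- The columns are the convergents pₖ₋₁/qₖ₋₁ and pₖ/qₖ of [0; a₁, a₂, …],
-- with p₋₁ = 1 and q₋₁ = 0.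
conv : (ℕ → ℕ) → ℕ → Mat
conv a zero    = I
conv a (suc k) = step (a k) (conv a k)

mat-cong : ∀ {x x′ y y′ z z′ w w′} → x ≡ x′ → y ≡ y′ → z ≡ z′ → w ≡ w′ →
           mat x y z w ≡ mat x′ y′ z′ w′
mat-cong refl refl refl refl = refl

⊗-identityʳ : ∀ A → A ⊗ I ≡ A
⊗-identityʳ (mat x y z w) = mat-cong (l x y) (r x y) (l z w) (r z w)
  where
  l : ∀ x y → x * 1 + y * 0 ≡ x
  l = ℕ.solve-∀
  r : ∀ x y → x * 0 + y * 1 ≡ y
  r = ℕ.solve-∀

⊗-step : ∀ c A B → A ⊗ step c B ≡ step c (A ⊗ B)
⊗-step c (mat x y z w) (mat x′ y′ z′ w′) = mat-cong refl (eq x y x′ y′ z′ w′ c) refl (eq z w x′ y′ z′ w′ c)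
  where
  eq : ∀ x y x′ y′ z′ w′ c → x * (x′ + y′ * c) + y * (z′ + w′ * c) ≡
       x * x′ + y * z′ + (x * y′ + y * w′) * c
  eq = ℕ.solve-∀

-- Each letter acts by right multiplication, so concatenating words multiplies their matrices. This
-- splits `conv a j` at `m` and at `m + y`, and a prefix of `w` into `Y` followed by a shorter
-- prefix.
conv-+ : ∀ a m k → conv a (m + k) ≡ conv a m ⊗ conv (λ i → a (m + i)) k
conv-+ a m zero rewrite +-identityʳ m = sym (⊗-identityʳ (conv a m))
conv-+ a m (suc k) rewrite +-suc m k =
  trans (cong (step (a (m + k))) (conv-+ a m k)) (sym (⊗-step (a (m + k)) (conv a m) _))

-- `conv` grows at the last letter, whereas `convergent` recurses on the first; inductions over the
-- first letter go through this form.
conv-suc : ∀ a k → conv a (suc k) ≡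
           let mat x y z w = conv (λ i → a (suc i)) k in mat z w (x + a 0 * z) (y + a 0 * w)
conv-suc a k = trans (conv-+ a 1 k) (eq (conv (λ i → a (suc i)) k))
  where
  e₁ : ∀ x z → 0 * x + 1 * z ≡ z
  e₁ = ℕ.solve-∀
  e₂ : ∀ c x z → 1 * x + (0 + 1 * c) * z ≡ x + c * z
  e₂ = ℕ.solve-∀
  eq : ∀ A → step (a 0) I ⊗ A ≡ let mat x y z w = A in mat z w (x + a 0 * z) (y + a 0 * w)
  eq (mat x y z w) = mat-cong (e₁ x z) (e₁ y w) (e₂ (a 0) x z) (e₂ (a 0) y w)

conv-cong : ∀ {a b} k → (∀ i → i < k → a i ≡ b i) → conv a k ≡ conv b k
conv-cong zero    a≗b = refl
conv-cong (suc k) a≗b = cong₂ step (a≗b k ≤-refl) (conv-cong k λ i i<k → a≗b i (m≤n⇒m≤1+n i<k))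

pos-+* : ∀ x y c → + (x + y * c) ≡ + x ℤ.+ + y ℤ.* + c
pos-+* x y c = trans (ℤ.pos-+ x (y * c)) (cong (λ t → + x ℤ.+ t) (ℤ.pos-* y c))

pos-*+* : ∀ x y z w → + (x * y + z * w) ≡ + x ℤ.* + y ℤ.+ + z ℤ.* + w
pos-*+* x y z w = trans (pos-+* (x * y) z w) (cong (ℤ._+ + z ℤ.* + w) (ℤ.pos-* x y))

det : Mat → ℤ
det (mat x y z w) = + x ℤ.* + w ℤ.- + y ℤ.* + z

det-step : ∀ c A → det (step c A) ≡ ℤ.- det A
det-step c (mat x y z w) =
  trans (cong₂ (λ s t → + y ℤ.* s ℤ.- t ℤ.* + w) (pos-+* z w c) (pos-+* x y c))
        (eq (+ x) (+ y) (+ z) (+ w) (+ c))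
  where
  eq : ∀ x y z w c → y ℤ.* (z ℤ.+ w ℤ.* c) ℤ.- (x ℤ.+ y ℤ.* c) ℤ.* w ≡ ℤ.- (x ℤ.* w ℤ.- y ℤ.* z)
  eq = ℤ.solve-∀

-- The sign alternates with `k`, so only the absolute value is kept. It allows cancelling a matrix
-- modulo `n` and gives the coprimality of `p` and `q`.
∣det-conv∣≡1 : ∀ a k → ℤ.∣ det (conv a k) ∣ ≡ 1
∣det-conv∣≡1 a zero    = refl
∣det-conv∣≡1 a (suc k) = trans (cong ℤ.∣_∣ (det-step (a k) (conv a k)))
  (trans (ℤ.∣-i∣≡∣i∣ (det (conv a k))) (∣det-conv∣≡1 a k))

-- Growth of the denominators

module Growth {a : ℕ → ℕ} (a>0 : ∀ k → 1 ≤ a k) where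

  *a≥ : ∀ k x → x ≤ x * a k
  *a≥ k x = ≤-trans (≤-reflexive (sym (*-identityʳ x))) (*-monoʳ-≤ x (a>0 k))

  q⁻≤q : ∀ k → q⁻ (conv a k) ≤ q (conv a k)
  q⁻≤q zero    = z≤n
  q⁻≤q (suc k) = ≤-trans (*a≥ k _) (m≤n+m _ _)

  q>0 : ∀ k → 1 ≤ q (conv a k)
  q>0 zero    = ≤-refl
  q>0 (suc k) = ≤-trans (q>0 k) (q⁻≤q (suc k))

  q≥ : ∀ k → k ≤ q (conv a k)
  q≥ zero          = z≤n
  q≥ (suc zero)    = q>0 1
  q≥ (suc (suc k)) = +-mono-≤ (q>0 k) (≤-trans (q≥ (suc k)) (*a≥ (suc k) _))

  -- After peeling off the first letter, `p` is the `q` of the shifted word, and `q` contains it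
  -- `a 0` times.
  p≤q : ∀ k → p (conv a k) ≤ q (conv a k)
  p≤q zero    = z≤n
  p≤q (suc k) = subst (λ A → p A ≤ q A) (sym (conv-suc a k))
    (≤-trans (≤-trans (*a≥ 0 _) (≤-reflexive (*-comm _ (a 0)))) (m≤n+m _ _))

  q⁻≥ : ∀ h k → 2 + h ≤ k → h ≤ q⁻ (conv a k)
  q⁻≥ h (suc (suc k)) (s≤s (s≤s h≤k)) = ≤-trans h≤k (≤-trans (n≤1+n k) (q≥ (suc k)))

  -- From qₖ ≥ qₖ₋₁ + qₖ₋₂ and qₖ₋₂ ≥ k - 2 ≥ h.
  q-gap : ∀ h k → 2 + h ≤ k → q⁻ (conv a k) + h ≤ q (conv a k)
  q-gap h (suc (suc k)) (s≤s (s≤s h≤k)) =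
    ≤-trans (+-mono-≤ (*a≥ (suc k) (q (conv a (suc k)))) (≤-trans h≤k (q≥ k)))
            (≤-reflexive (+-comm _ (q (conv a k))))

  -- The determinant ∣qₘ₋₁qₗ - qₘqₗ₋₁∣ is unchanged when equal last letters
  -- are removed from both words; once they differ, or m = 0, the bound is
  -- immediate.
  q-far : ∀ h m k → 2 + h ≤ k → let A = conv a m ; B = conv a (m + k) in
          q⁻ A * q B + h ≤ q A * q⁻ B ⊎ q A * q⁻ B + h ≤ q⁻ A * q B
  q-far h zero    k 2+h≤k =
    inj₁ (≤-trans (q⁻≥ h k 2+h≤k) (≤-reflexive (sym (+-identityʳ _))))
  q-far h (suc m) k 2+h≤k = go (<-cmp (a m) (a (m + k))) (q-far h m k 2+h≤k)
    where
    open ≤-Reasoning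
    u = q (conv a m)
    v = q⁻ (conv a m)
    x = q (conv a (m + k))
    y = q⁻ (conv a (m + k))
    b = a m
    c = a (m + k)
    2+h≤m+k = ≤-trans 2+h≤k (m≤n+m k m)
    u* : ∀ t → t ≤ u * t
    u* t = ≤-trans (≤-reflexive (sym (*-identityˡ t))) (*-monoˡ-≤ t (q>0 m))
    e₁ : ∀ u x y c h → u * y + h + u * x * c ≡ u * (y + x * c) + h
    e₁ = ℕ.solve-∀
    e₂ : ∀ u v x c h → v * x + h + u * x * c ≡ (v + u * c) * x + h
    e₂ = ℕ.solve-∀
    e₃ : ∀ u v x c → v * x + u * x * c ≡ (v + u * c) * x
    e₃ = ℕ.solve-∀
    e₄ : ∀ u x y c → u * y + u * x * c ≡ u * (y + x * c)
    e₄ = ℕ.solve-∀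
    e₅ : ∀ u x y b d → u * x + u * y + u * x * b + u * x * d ≡ u * (y + x * (suc b + d))
    e₅ = ℕ.solve-∀
    e₆ : ∀ u v x c d → u * x + u * x * c + (v * x + u * x * d) ≡ (v + u * (suc c + d)) * x
    e₆ = ℕ.solve-∀
    -- Here the right side has at least one more `u * x`, which covers `v * x`, while `u * y` covers
    -- `h`.
    bigger : ∀ d → suc b + d ≡ c → (v + u * b) * x + h ≤ u * (y + x * c)
    bigger d e = begin
      (v + u * b) * x + h                    ≡⟨ e₂ u v x b h ⟨
      v * x + h + u * x * b                  ≤⟨ +-monoˡ-≤ (u * x * b) (+-mono-≤ (*-monoˡ-≤ x (q⁻≤q m))
                                                 (≤-trans (q⁻≥ h (m + k) 2+h≤m+k) (u* y))) ⟩
      u * x + u * y + u * x * b              ≤⟨ m≤m+n _ (u * x * d) ⟩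
      u * x + u * y + u * x * b + u * x * d  ≡⟨ e₅ u x y b d ⟩
      u * (y + x * (suc b + d))              ≡⟨ cong (λ t → u * (y + x * t)) e ⟩
      u * (y + x * c)                        ∎
    -- Now the left letter is larger, and its extra `u * x` exceeds `u * y` by at least `h` because
    -- of `q-gap`.
    smaller : ∀ d → suc c + d ≡ b → u * (y + x * c) + h ≤ (v + u * b) * x
    smaller d e = begin
      u * (y + x * c) + h                    ≡⟨ e₁ u x y c h ⟨
      u * y + h + u * x * c                  ≤⟨ +-monoˡ-≤ (u * x * c) (begin
        u * y + h                              ≤⟨ +-monoʳ-≤ (u * y) (u* h) ⟩
        u * y + u * h                          ≡⟨ *-distribˡ-+ u y h ⟨
        u * (y + h)                            ≤⟨ *-monoʳ-≤ u (q-gap h (m + k) 2+h≤m+k) ⟩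
        u * x                                  ∎) ⟩
      u * x + u * x * c                      ≤⟨ m≤m+n _ (v * x + u * x * d) ⟩
      u * x + u * x * c + (v * x + u * x * d) ≡⟨ e₆ u v x c d ⟩
      (v + u * (suc c + d)) * x              ≡⟨ cong (λ t → (v + u * t) * x) e ⟩
      (v + u * b) * x                        ∎
    go : _ → v * x + h ≤ u * y ⊎ u * y + h ≤ v * x →
         u * (y + x * c) + h ≤ (v + u * b) * x ⊎ (v + u * b) * x + h ≤ u * (y + x * c)
    go (tri< b<c _ _) _ with m≤n⇒∃[o]m+o≡n b<c
    ... | d , e = inj₂ (bigger d e)
    go (tri> _ _ c<b) _ with m≤n⇒∃[o]m+o≡n c<b
    ... | d , e = inj₁ (smaller d e)
    -- Equal letters add `u * x * c` to both sides. The alternatives swap because the determinant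
    -- changes sign.
    go (tri≈ _ b≡c _) (inj₁ l) = inj₂ (begin
      (v + u * b) * x + h    ≡⟨ cong (λ t → (v + u * t) * x + h) b≡c ⟩
      (v + u * c) * x + h    ≡⟨ e₂ u v x c h ⟨
      v * x + h + u * x * c  ≤⟨ +-monoˡ-≤ (u * x * c) l ⟩
      u * y + u * x * c      ≡⟨ e₄ u x y c ⟩
      u * (y + x * c)        ∎)
    go (tri≈ _ b≡c _) (inj₂ l) = inj₁ (begin
      u * (y + x * c) + h    ≡⟨ e₁ u x y c h ⟨
      u * y + h + u * x * c  ≤⟨ +-monoˡ-≤ (u * x * c) l ⟩
      v * x + u * x * c      ≡⟨ e₃ u v x c ⟩
      (v + u * c) * x        ≡⟨ cong (λ t → (v + u * t) * x) b≡c ⟨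
      (v + u * b) * x        ∎)

-- Multiples of α close to integers

∣+m-+n∣≤m⊔n : ∀ m n → ℤ.∣ + m ℤ.- + n ∣ ≤ m ⊔ n
∣+m-+n∣≤m⊔n m n = subst (λ i → ℤ.∣ i ∣ ≤ m ⊔ n) (sym (ℤ.m-n≡m⊖n m n)) (ℤ.∣m⊝n∣≤m⊔n m n)

gap⇒≤∣-∣ : ∀ {h} m n → m + h ≤ n ⊎ n + h ≤ m → h ≤ ℤ.∣ + m ℤ.- + n ∣
gap⇒≤∣-∣ {h} m n (inj₂ n+h≤m) =
  subst (λ i → h ≤ ℤ.∣ i ∣) (sym (trans (ℤ.m-n≡m⊖n m n) (ℤ.⊖-≥ (≤-trans (m≤m+n n h) n+h≤m))))
    (m+n≤o⇒m≤o∸n h (≤-trans (≤-reflexive (+-comm h n)) n+h≤m))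
gap⇒≤∣-∣ {h} m n (inj₁ m+h≤n) =
  subst (h ≤_) (ℤ.∣i-j∣≡∣j-i∣ (+ n) (+ m)) (gap⇒≤∣-∣ n m (inj₂ m+h≤n))

-- Used with A = Mₘ and B = Mₗ; P is then the numerator approximating Qα.

Q P : Mat → Mat → ℤ
Q A B = + q⁻ A ℤ.* + q B ℤ.- + q A ℤ.* + q⁻ B
P A B = + q⁻ A ℤ.* + p B ℤ.- + q A ℤ.* + p⁻ B

Q-pos : ∀ A B → Q A B ≡ + (q⁻ A * q B) ℤ.- + (q A * q⁻ B)
Q-pos A B = sym (cong₂ ℤ._-_ (ℤ.pos-* (q⁻ A) (q B)) (ℤ.pos-* (q A) (q⁻ B)))

-- A difference of two naturals is at most the larger of them, so no factor 2 is lost here.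
∣Q∣≤ : ∀ A B → q⁻ A ≤ q A → q⁻ B ≤ q B → ℤ.∣ Q A B ∣ ≤ q A * q B
∣Q∣≤ A B A≤ B≤ = subst (λ i → ℤ.∣ i ∣ ≤ q A * q B) (sym (Q-pos A B))
  (≤-trans (∣+m-+n∣≤m⊔n (q⁻ A * q B) (q A * q⁻ B)) (⊔-lub (*-monoˡ-≤ (q B) A≤) (*-monoʳ-≤ (q A) B≤)))

≤∣Q∣ : ∀ {h} A B → q⁻ A * q B + h ≤ q A * q⁻ B ⊎ q A * q⁻ B + h ≤ q⁻ A * q B → h ≤ ℤ.∣ Q A B ∣
≤∣Q∣ {h} A B gap = subst (λ i → h ≤ ℤ.∣ i ∣) (sym (Q-pos A B)) (gap⇒≤∣-∣ _ _ gap)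

-- The column (P, Q) is `B` applied to (- q A, q⁻ A), and the last column of `B ⊗ Z` is `B` applied
-- to (p Z, q Z). The left side is the determinant of these two images, hence `det B` times that of
-- the originals.
Qp-Pq : ∀ A B Z → Q A B ℤ.* + p (B ⊗ Z) ℤ.- P A B ℤ.* + q (B ⊗ Z)
                ≡ det B ℤ.* + (q⁻ A * p Z + q A * q Z)
Qp-Pq A@(mat _ _ s r) B@(mat x y z w) (mat _ e _ f) = begin
  Q A B ℤ.* + (x * e + y * f) ℤ.- P A B ℤ.* + (z * e + w * f)
    ≡⟨ cong₂ (λ i j → Q A B ℤ.* i ℤ.- P A B ℤ.* j) (pos-*+* x e y f) (pos-*+* z e w f) ⟩
  Q A B ℤ.* (+ x ℤ.* + e ℤ.+ + y ℤ.* + f) ℤ.- P A B ℤ.* (+ z ℤ.* + e ℤ.+ + w ℤ.* + f)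
    ≡⟨ eq (+ s) (+ r) (+ x) (+ y) (+ z) (+ w) (+ e) (+ f) ⟩
  det B ℤ.* (+ s ℤ.* + e ℤ.+ + r ℤ.* + f)
    ≡⟨ cong (det B ℤ.*_) (pos-*+* s e r f) ⟨
  det B ℤ.* + (s * e + r * f) ∎
  where
  open ≡-Reasoning
  eq : ∀ s r x y z w e f →
       (s ℤ.* w ℤ.- r ℤ.* z) ℤ.* (x ℤ.* e ℤ.+ y ℤ.* f) ℤ.- (s ℤ.* y ℤ.- r ℤ.* x) ℤ.* (z ℤ.* e ℤ.+ w ℤ.* f)
       ≡ (x ℤ.* w ℤ.- y ℤ.* z) ℤ.* (s ℤ.* e ℤ.+ r ℤ.* f)
  eq = ℤ.solve-∀

-- The multiplier is at most `q A * q B` and the error at most `2 * (q A * q Z)`. Their product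
-- depends on `B` and `Z` only through `q B * q Z`, which is one of the two summands of `q (B ⊗ Z)`.
∣Q∣*∣Qp-Pq∣≤ : ∀ A B Z → ℤ.∣ det B ∣ ≡ 1 → q⁻ A ≤ q A → q⁻ B ≤ q B → p Z ≤ q Z →
  ℤ.∣ Q A B ∣ * ℤ.∣ Q A B ℤ.* + p (B ⊗ Z) ℤ.- P A B ℤ.* + q (B ⊗ Z) ∣ ≤ 2 * (q A * q A) * q (B ⊗ Z)
∣Q∣*∣Qp-Pq∣≤ A B Z ∣det∣≡1 A≤ B≤ Z≤ = begin
  ℤ.∣ Q A B ∣ * ℤ.∣ Q A B ℤ.* + p (B ⊗ Z) ℤ.- P A B ℤ.* + q (B ⊗ Z) ∣
    ≡⟨ cong (λ i → ℤ.∣ Q A B ∣ * ℤ.∣ i ∣) (Qp-Pq A B Z) ⟩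
  ℤ.∣ Q A B ∣ * ℤ.∣ det B ℤ.* + (q⁻ A * p Z + q A * q Z) ∣
    ≡⟨ cong (ℤ.∣ Q A B ∣ *_) (ℤ.abs-* (det B) _) ⟩
  ℤ.∣ Q A B ∣ * (ℤ.∣ det B ∣ * (q⁻ A * p Z + q A * q Z))
    ≡⟨ cong (λ d → ℤ.∣ Q A B ∣ * (d * (q⁻ A * p Z + q A * q Z))) ∣det∣≡1 ⟩
  ℤ.∣ Q A B ∣ * (1 * (q⁻ A * p Z + q A * q Z))
    ≤⟨ *-mono-≤ (∣Q∣≤ A B A≤ B≤) (*-monoʳ-≤ 1 (+-monoˡ-≤ (q A * q Z) (*-mono-≤ A≤ Z≤))) ⟩
  q A * q B * (1 * (q A * q Z + q A * q Z))
    ≡⟨ eq (q A) (q B) (q Z) ⟩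
  2 * (q A * q A) * (q B * q Z)
    ≤⟨ *-monoʳ-≤ (2 * (q A * q A)) (m≤n+m _ (q⁻ B * p Z)) ⟩
  2 * (q A * q A) * q (B ⊗ Z) ∎
  where
  open ≤-Reasoning
  eq : ∀ a b c → a * b * (1 * (a * c + a * c)) ≡ 2 * (a * a) * (b * c)
  eq = ℕ.solve-∀

-- Matrices modulo n

infix 4 _≡_[mod_]

record _≡_[mod_] (A B : Mat) (n : ℕ) : Set where
  constructor cong-mod
  field
    ∣p⁻ : + n ℤ.∣ + p⁻ A ℤ.- + p⁻ B
    ∣p  : + n ℤ.∣ + p A ℤ.- + p B
    ∣q⁻ : + n ℤ.∣ + q⁻ A ℤ.- + q⁻ B
    ∣q  : + n ℤ.∣ + q A ℤ.- + q B

mod-≡⇒∣- : ∀ x y n .{{_ : NonZero n}} → x mod n ≡ y mod n → + n ℤ.∣ + x ℤ.- + y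
mod-≡⇒∣- x y n e = ℤ.divides (+ (x ℕ./ n) ℤ.- + (y ℕ./ n)) (begin
  + x ℤ.- + y
    ≡⟨ cong₂ (λ s t → + s ℤ.- + t) (m≡m%n+[m/n]*n x n) (m≡m%n+[m/n]*n y n) ⟩
  + (x % n + (x ℕ./ n) * n) ℤ.- + (y % n + (y ℕ./ n) * n)
    ≡⟨ cong₂ ℤ._-_ (pos-+* (x % n) (x ℕ./ n) n) (pos-+* (y % n) (y ℕ./ n) n) ⟩
  (+ (x % n) ℤ.+ + (x ℕ./ n) ℤ.* + n) ℤ.- (+ (y % n) ℤ.+ + (y ℕ./ n) ℤ.* + n)
    ≡⟨ cong (λ r → (+ r ℤ.+ + (x ℕ./ n) ℤ.* + n) ℤ.- (+ (y % n) ℤ.+ + (y ℕ./ n) ℤ.* + n)) x%n≡y%n ⟩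
  (+ (y % n) ℤ.+ + (x ℕ./ n) ℤ.* + n) ℤ.- (+ (y % n) ℤ.+ + (y ℕ./ n) ℤ.* + n)
    ≡⟨ eq (+ (y % n)) (+ (x ℕ./ n)) (+ (y ℕ./ n)) (+ n) ⟩
  (+ (x ℕ./ n) ℤ.- + (y ℕ./ n)) ℤ.* + n ∎)
  where
  open ≡-Reasoning
  x%n≡y%n : x % n ≡ y % n
  x%n≡y%n = trans (sym (toℕ-fromℕ< (m%n<n x n))) (trans (cong toℕ e) (toℕ-fromℕ< (m%n<n y n)))
  eq : ∀ r s t n → (r ℤ.+ s ℤ.* n) ℤ.- (r ℤ.+ t ℤ.* n) ≡ (s ℤ.- t) ℤ.* n
  eq = ℤ.solve-∀

residue : ∀ n .{{_ : NonZero n}} → Mat → Fin (n * n * (n * n))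
residue n (mat x y z w) = combine (combine (x mod n) (y mod n)) (combine (z mod n) (w mod n))

residue-≡⇒ : ∀ n .{{_ : NonZero n}} A B → residue n A ≡ residue n B → A ≡ B [mod n ]
residue-≡⇒ n (mat x y z w) (mat x′ y′ z′ w′) e =
  let xy , zw = combine-injective (combine (x mod n) (y mod n)) (combine (z mod n) (w mod n))
                                  (combine (x′ mod n) (y′ mod n)) (combine (z′ mod n) (w′ mod n)) e
      ex , ey = combine-injective (x mod n) (y mod n) (x′ mod n) (y′ mod n) xy
      ez , ew = combine-injective (z mod n) (w mod n) (z′ mod n) (w′ mod n) zw
  in cong-mod (mod-≡⇒∣- x x′ n ex) (mod-≡⇒∣- y y′ n ey) (mod-≡⇒∣- z z′ n ez) (mod-≡⇒∣- w w′ n ew)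

∣i∣≡1⇒∣ : ∀ i {n j} → ℤ.∣ i ∣ ≡ 1 → n ℤ.∣ i ℤ.* j → n ℤ.∣ j
∣i∣≡1⇒∣ i {n} {j} ∣i∣≡1 n∣ij = ℤ.∣ᵤ⇒∣ (subst (ℤ.∣ n ∣ ℕ.∣_)
  (trans (ℤ.abs-* i j) (trans (cong (_* ℤ.∣ j ∣) ∣i∣≡1) (*-identityˡ _))) (ℤ.∣⇒∣ᵤ n∣ij))

-- Cancelling the unimodular Z gives Y ≡ I, and Q A (A ⊗ I) = 0.
∣Q : ∀ {n} A Y Z → ℤ.∣ det Z ∣ ≡ 1 → Y ⊗ Z ≡ Z [mod n ] → + n ℤ.∣ Q A (A ⊗ Y)
∣Q {n} A@(mat _ _ s r) Y@(mat x y z w) Z@(mat e f g h) ∣det∣≡1 (cong-mod n∣₁ n∣₂ n∣₃ n∣₄) =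
  ∣i∣≡1⇒∣ (det Z) ∣det∣≡1 (subst (+ n ℤ.∣_) (sym expand)
    (ℤ.∣m∣n⇒∣m+n (ℤ.∣m∣n⇒∣m+n (ℤ.∣n⇒∣m*n c₁ n∣₁) (ℤ.∣n⇒∣m*n c₂ n∣₂))
                 (ℤ.∣m∣n⇒∣m+n (ℤ.∣n⇒∣m*n c₃ n∣₃) (ℤ.∣n⇒∣m*n c₄ n∣₄))))
  where
  open ≡-Reasoning
  -- `Q A (A ⊗ Y)` is the row (s, r) times Y - I times the column (- r, s), and `det Z` times Y - I
  -- is Y ⊗ Z - Z times the adjugate of `Z`. The coefficients are the products of an entry of the
  -- row with an entry of the adjugate applied to the column.
  c : ℤ → ℤ → ℤ
  c i j = + s ℤ.* i ℤ.+ + r ℤ.* j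
  c₁ = ℤ.- (+ s ℤ.* c (+ f) (+ h))
  c₂ = + s ℤ.* c (+ e) (+ g)
  c₃ = ℤ.- (+ r ℤ.* c (+ f) (+ h))
  c₄ = + r ℤ.* c (+ e) (+ g)
  eq : ∀ s r x y z w e f g h →
    (e ℤ.* h ℤ.- f ℤ.* g) ℤ.* (s ℤ.* (s ℤ.* y ℤ.+ r ℤ.* w) ℤ.- r ℤ.* (s ℤ.* x ℤ.+ r ℤ.* z)) ≡
      ℤ.- (s ℤ.* (s ℤ.* f ℤ.+ r ℤ.* h)) ℤ.* (x ℤ.* e ℤ.+ y ℤ.* g ℤ.- e) ℤ.+ s ℤ.* (s ℤ.* e ℤ.+ r ℤ.* g) ℤ.* (x ℤ.* f ℤ.+ y ℤ.* h ℤ.- f)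
      ℤ.+ (ℤ.- (r ℤ.* (s ℤ.* f ℤ.+ r ℤ.* h)) ℤ.* (z ℤ.* e ℤ.+ w ℤ.* g ℤ.- g) ℤ.+ r ℤ.* (s ℤ.* e ℤ.+ r ℤ.* g) ℤ.* (z ℤ.* f ℤ.+ w ℤ.* h ℤ.- h))
  eq = ℤ.solve-∀
  expand : det Z ℤ.* Q A (A ⊗ Y) ≡
    c₁ ℤ.* (+ p⁻ (Y ⊗ Z) ℤ.- + e) ℤ.+ c₂ ℤ.* (+ p (Y ⊗ Z) ℤ.- + f)
    ℤ.+ (c₃ ℤ.* (+ q⁻ (Y ⊗ Z) ℤ.- + g) ℤ.+ c₄ ℤ.* (+ q (Y ⊗ Z) ℤ.- + h))
  expand = begin
    det Z ℤ.* Q A (A ⊗ Y)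
      ≡⟨ cong₂ (λ i j → det Z ℤ.* (+ s ℤ.* i ℤ.- + r ℤ.* j)) (pos-*+* s y r w) (pos-*+* s x r z) ⟩
    _ ≡⟨ eq (+ s) (+ r) (+ x) (+ y) (+ z) (+ w) (+ e) (+ f) (+ g) (+ h) ⟩
    _ ≡⟨ cong₂ ℤ._+_
           (cong₂ (λ i j → c₁ ℤ.* (i ℤ.- + e) ℤ.+ c₂ ℤ.* (j ℤ.- + f)) (pos-*+* x e y g) (pos-*+* x f y h))
           (cong₂ (λ i j → c₃ ℤ.* (i ℤ.- + g) ℤ.+ c₄ ℤ.* (j ℤ.- + h)) (pos-*+* z e w g) (pos-*+* z f w h)) ⟨
    _ ∎

-- Recurrence

module Returns {w : ℕ → ℕ} (w-recurrent : Recurrent w) (N : ℕ) where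

  return : ∀ l → ∃[ j ] N ≤ j × (∀ t → t < l → w (j + t) ≡ w t)
  return l with w-recurrent (tabulate {n = l} (λ k → w (toℕ k))) 0 (λ k → sym (lookup∘tabulate _ k)) N
  ... | j , N≤j , occurs = j , N≤j , λ t t<l →
    subst (λ s → w (j + s) ≡ w s) (toℕ-fromℕ< t<l) (trans (occurs (fromℕ< t<l)) (lookup∘tabulate _ (fromℕ< t<l)))

  -- Lengths of prefixes U₀, U₁, … such that each Uᵢ is a suffix of all
  -- later ones: Uᵢ₊₁ ends with a late occurrence of Uᵢ.
  len : ℕ → ℕ
  len zero    = 0
  len (suc i) = proj₁ (return (len i)) + len i

  -- Returns compose: Uᵢ ends Uⱼ, and Uⱼ ends the next prefix. The bound `N ≤ y` comes from the last
  -- return alone.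
  suffix : ∀ {i j} → i < j → ∃[ y ] N ≤ y × y + len i ≡ len j × (∀ t → t < len i → w (y + t) ≡ w t)
  suffix {i} {suc j} (s≤s i≤j) with m≤n⇒m<n∨m≡n i≤j
  ... | inj₂ refl = let x , N≤x , x-return = return (len i) in x , N≤x , refl , x-return
  ... | inj₁ i<j  =
    let x , N≤x , x-return      = return (len j)
        y , _ , y+len≡ , agrees = suffix i<j
    in x + y , ≤-trans N≤x (m≤m+n x y) ,
       trans (+-assoc x y (len i)) (cong (λ s → x + s) y+len≡) ,
       λ t t<len → trans (cong w (+-assoc x y t))
         (trans (x-return (y + t) (subst (y + t <_) y+len≡ (+-monoʳ-< y t<len))) (agrees t t<len))

  conv-fixes : ∀ n .{{_ : NonZero n}} → ∃₂ λ y l → N ≤ y × conv w y ⊗ conv w l ≡ conv w l [mod n ]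
  -- There are n⁴ residue classes of matrices, and the prefixes U₀, ..., Uₙ⁴ are one more.
  conv-fixes n with pigeonhole (n<1+n (n * n * (n * n))) (λ i → residue n (conv w (len (toℕ i))))
  ... | i , j , i<j , same-residue with suffix i<j
  ... | y , N≤y , y+len≡ , y-suffix = y , l , N≤y ,
    subst (λ A → A ≡ conv w l [mod n ]) product (residue-≡⇒ n _ _ (sym same-residue))
    where
    l = len (toℕ i)
    product : conv w (len (toℕ j)) ≡ conv w y ⊗ conv w l
    product = trans (cong (conv w) (sym y+len≡))
      (trans (conv-+ w y l) (cong (conv w y ⊗_) (conv-cong l y-suffix)))

-- Good multiples of nα

-- The multiplier must be a natural number, so `Q` is replaced by its absolute value; flipping the
-- sign of `P` along with it preserves the error.
unsigned : ∀ i j b c → ∃[ k ] ℤ.∣ + ℤ.∣ i ∣ ℤ.* b ℤ.- k ℤ.* c ∣ ≡ ℤ.∣ i ℤ.* b ℤ.- j ℤ.* c ∣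
unsigned i j b c with ℤ.+∣i∣≡i⊎+∣i∣≡-i i
... | inj₁ e = j , cong (λ t → ℤ.∣ t ℤ.* b ℤ.- j ℤ.* c ∣) e
... | inj₂ e = ℤ.- j , trans (cong ℤ.∣_∣ (trans (cong (λ t → t ℤ.* b ℤ.- ℤ.- j ℤ.* c) e) (eq i j b c)))
                             (ℤ.∣-i∣≡∣i∣ (i ℤ.* b ℤ.- j ℤ.* c))
  where
  eq : ∀ i j b c → ℤ.- i ℤ.* b ℤ.- ℤ.- j ℤ.* c ≡ ℤ.- (i ℤ.* b ℤ.- j ℤ.* c)
  eq = ℤ.solve-∀

-- s ‖s n pⱼ/qⱼ‖ ≤ C/n for all large j, cleared of denominators.
GoodMultiple : (a : ℕ → ℕ) (n C s : ℕ) → Set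
GoodMultiple a n C s = ∃[ L ] (∀ j → L ≤ j → ∃[ t ]
  s * ℤ.∣ + (s * n) ℤ.* + p (conv a j) ℤ.- t ℤ.* + q (conv a j) ∣ * n ≤ C * q (conv a j))

-- The multiplier has the form `suc (N + k)` because this is the factor at index `k` of the `N`-th
-- tail in `lagrangeConstant`.
goodMultiples : ∀ {a} → (∀ k → 1 ≤ a k) → ∀ m → Recurrent (λ i → a (m + i)) →
  ∀ n .{{_ : NonZero n}} N → ∃[ k ] GoodMultiple a n (2 * (q (conv a m) * q (conv a m))) (suc (N + k))
-- A return this late makes `q-far`, whose offset is the 2, give ∣Q∣ ≥ (N + 1)n; dividing by `n`
-- leaves a multiplier of at least N + 1.
goodMultiples {a} a>0 m recurrent n N = found (Returns.conv-fixes recurrent (2 + suc N * n) n)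
  where
  open Growth a>0
  w = λ i → a (m + i)
  A = conv a m
  C = 2 * (q A * q A)
  multiple : ∀ y s → ℤ.∣ Q A (conv a (m + y)) ∣ ≡ s * n → GoodMultiple a n C s
  multiple y s ∣Q∣≡s*n = m + y , good
    where
    B = conv a (m + y)
    good : ∀ j → m + y ≤ j → ∃[ t ]
      s * ℤ.∣ + (s * n) ℤ.* + p (conv a j) ℤ.- t ℤ.* + q (conv a j) ∣ * n ≤ C * q (conv a j)
    good j m+y≤j with m≤n⇒∃[o]m+o≡n m+y≤j
    ... | o , refl rewrite conv-+ a (m + y) o = t , (begin
      s * ℤ.∣ + (s * n) ℤ.* + pⱼ ℤ.- t ℤ.* + qⱼ ∣ * n
        ≡⟨ eq s _ n ⟩
      s * n * ℤ.∣ + (s * n) ℤ.* + pⱼ ℤ.- t ℤ.* + qⱼ ∣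
        ≡⟨ cong (λ i → i * ℤ.∣ + i ℤ.* + pⱼ ℤ.- t ℤ.* + qⱼ ∣) ∣Q∣≡s*n ⟨
      ℤ.∣ Q A B ∣ * ℤ.∣ + ℤ.∣ Q A B ∣ ℤ.* + pⱼ ℤ.- t ℤ.* + qⱼ ∣
        ≡⟨ cong (ℤ.∣ Q A B ∣ *_) (proj₂ (unsigned (Q A B) (P A B) (+ pⱼ) (+ qⱼ))) ⟩
      ℤ.∣ Q A B ∣ * ℤ.∣ Q A B ℤ.* + pⱼ ℤ.- P A B ℤ.* + qⱼ ∣
        ≤⟨ ∣Q∣*∣Qp-Pq∣≤ A B Z (∣det-conv∣≡1 a (m + y)) (q⁻≤q m) (q⁻≤q (m + y)) (Growth.p≤q (λ i → a>0 (m + y + i)) o) ⟩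
      C * qⱼ ∎)
      where
      open ≤-Reasoning
      Z = conv (λ i → a (m + y + i)) o
      pⱼ = p (B ⊗ Z)
      qⱼ = q (B ⊗ Z)
      t = proj₁ (unsigned (Q A B) (P A B) (+ pⱼ) (+ qⱼ))
      eq : ∀ s x n → s * x * n ≡ s * n * x
      eq = ℕ.solve-∀
  found : (∃₂ λ y l → 2 + suc N * n ≤ y × conv w y ⊗ conv w l ≡ conv w l [mod n ]) →
          ∃[ k ] GoodMultiple a n C (suc (N + k))
  found (y , l , 2+h≤y , fixes) = large (m≤n⇒∃[o]m+o≡n (*-cancelʳ-≤ (suc N) s n
    (subst (suc N * n ≤_) ∣Q∣≡s*n (≤∣Q∣ A (conv a (m + y)) (q-far (suc N * n) m y 2+h≤y)))))
    where
    n∣Q : n ℕ.∣ ℤ.∣ Q A (conv a (m + y)) ∣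
    n∣Q = ℤ.∣⇒∣ᵤ (subst (λ B → + n ℤ.∣ Q A B) (sym (conv-+ a m y))
      (∣Q A (conv w y) (conv w l) (∣det-conv∣≡1 w l) fixes))
    s = ℕ.quotient n∣Q
    ∣Q∣≡s*n = ℕ._∣_.equality n∣Q
    large : ∃[ k ] suc N + k ≡ s → ∃[ k ] GoodMultiple a n C (suc (N + k))
    large (k , 1+N+k≡s) = k , subst (GoodMultiple a n C) (sym 1+N+k≡s) (multiple y s ∣Q∣≡s*n)

-- Lagrange constants

toℚᵘ-/ : ∀ i n .{{_ : NonZero n}} → ℚ.toℚᵘ (i / n) ℚᵘ.≃ i ℚᵘ./ n
toℚᵘ-/ i (suc n) = ℚ.toℚᵘ-fromℚᵘ (ℚᵘ.mkℚᵘ i n)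

/1-* : ∀ i j → (i ℤ.* j) / 1 ≡ i / 1 ℚ.* (j / 1)
/1-* i j = ℚ.toℚᵘ-injective (begin
  ℚ.toℚᵘ ((i ℤ.* j) / 1)                  ≈⟨ toℚᵘ-/ (i ℤ.* j) 1 ⟩
  ℚᵘ.mkℚᵘ i 0 ℚᵘ.* ℚᵘ.mkℚᵘ j 0            ≈⟨ ℚᵘ.*-cong (toℚᵘ-/ i 1) (toℚᵘ-/ j 1) ⟨
  ℚ.toℚᵘ (i / 1) ℚᵘ.* ℚ.toℚᵘ (j / 1)      ≈⟨ ℚ.toℚᵘ-homo-* (i / 1) (j / 1) ⟨
  ℚ.toℚᵘ (i / 1 ℚ.* (j / 1))                ∎)
  where open ℚᵘ.≃-Reasoning

/1-+ : ∀ i j → (i ℤ.+ j) / 1 ≡ i / 1 ℚ.+ j / 1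
/1-+ i j = ℚ.toℚᵘ-injective (begin
  ℚ.toℚᵘ ((i ℤ.+ j) / 1)                  ≈⟨ toℚᵘ-/ (i ℤ.+ j) 1 ⟩
  ℚᵘ.mkℚᵘ (i ℤ.+ j) 0                     ≈⟨ ℚᵘ.*≡* (eq i j) ⟩
  ℚᵘ.mkℚᵘ i 0 ℚᵘ.+ ℚᵘ.mkℚᵘ j 0            ≈⟨ ℚᵘ.+-cong (toℚᵘ-/ i 1) (toℚᵘ-/ j 1) ⟨
  ℚ.toℚᵘ (i / 1) ℚᵘ.+ ℚ.toℚᵘ (j / 1)      ≈⟨ ℚ.toℚᵘ-homo-+ (i / 1) (j / 1) ⟨
  ℚ.toℚᵘ (i / 1 ℚ.+ j / 1)                ∎)
  where
  open ℚᵘ.≃-Reasoning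
  eq : ∀ i j → (i ℤ.+ j) ℤ.* + 1 ≡ (i ℤ.* + 1 ℤ.+ j ℤ.* + 1) ℤ.* + 1
  eq = ℤ.solve-∀

/1-neg : ∀ i → (ℤ.- i) / 1 ≡ ℚ.- (i / 1)
/1-neg i = ℚ.toℚᵘ-injective (begin
  ℚ.toℚᵘ ((ℤ.- i) / 1)   ≈⟨ toℚᵘ-/ (ℤ.- i) 1 ⟩
  ℚᵘ.- ℚᵘ.mkℚᵘ i 0       ≈⟨ ℚᵘ.-‿cong (toℚᵘ-/ i 1) ⟨
  ℚᵘ.- ℚ.toℚᵘ (i / 1)    ≈⟨ ℚ.toℚᵘ-homo‿- (i / 1) ⟨
  ℚ.toℚᵘ (ℚ.- (i / 1))   ∎)
  where open ℚᵘ.≃-Reasoning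

/1-abs : ∀ i → fromℕ ℤ.∣ i ∣ ≡ ℚ.∣ i / 1 ∣
/1-abs (+ n)      = sym (ℚ.0≤p⇒∣p∣≡p (ℚ.nonNegative⁻¹ (fromℕ n) {{fromℕ-nonNeg n}}))
/1-abs ℤ.-[1+ n ] = sym (trans (ℚ.∣-p∣≡∣p∣ (fromℕ (suc n))) (sym (/1-abs (+ suc n))))

fromℕ-* : ∀ m n → fromℕ (m * n) ≡ fromℕ m ℚ.* fromℕ n
fromℕ-* m n = trans (cong (_/ 1) (ℤ.pos-* m n)) (/1-* (+ m) (+ n))

fromℕ-+ : ∀ m n → fromℕ (m + n) ≡ fromℕ m ℚ.+ fromℕ n
fromℕ-+ m n = /1-+ (+ m) (+ n)

fromℕ-mono : ∀ {m n} → m ≤ n → fromℕ m ℚ.≤ fromℕ n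
fromℕ-mono m≤n = /1-mono (ℤ.+≤+ m≤n)

/-cancel : ∀ c n .{{_ : NonZero n}} → + c / n ℚ.* fromℕ n ≡ fromℕ c
/-cancel c n@(suc _) = ℚ.toℚᵘ-injective (begin
  ℚ.toℚᵘ (+ c / n ℚ.* fromℕ n)               ≈⟨ ℚ.toℚᵘ-homo-* (+ c / n) (fromℕ n) ⟩
  ℚ.toℚᵘ (+ c / n) ℚᵘ.* ℚ.toℚᵘ (fromℕ n)     ≈⟨ ℚᵘ.*-cong (toℚᵘ-/ (+ c) n) (toℚᵘ-/ (+ n) 1) ⟩
  (+ c ℚᵘ./ n) ℚᵘ.* (+ n ℚᵘ./ 1)             ≈⟨ ℚᵘ.*≡* (eq (+ c) (+ n)) ⟩
  + c ℚᵘ./ 1                                 ≈⟨ toℚᵘ-/ (+ c) 1 ⟨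
  ℚ.toℚᵘ (fromℕ c)                           ∎)
  where
  open ℚᵘ.≃-Reasoning
  eq : ∀ c n → c ℤ.* n ℤ.* + 1 ≡ c ℤ.* (n ℤ.* + 1)
  eq = ℤ.solve-∀

-- Matrix entries and reduced fractions

-- Induction on the first letter, generalised over `a` since the tail is a shifted word; the product
-- form avoids dividing by `q`.
q*convergent : ∀ a .{{_ : ∀ {k} → NonZero (a k)}} k →
  fromℕ (q (conv a k)) ℚ.* convergent a k ≡ fromℕ (p (conv a k))
q*convergent a zero    = refl
q*convergent a (suc k) = subst (λ A → fromℕ (q A) ℚ.* convergent a (suc k) ≡ fromℕ (p A))
  (sym (conv-suc a k)) (begin
  fromℕ (p A + a 0 * q A) ℚ.* ℚ.1/ D
    ≡⟨ cong (ℚ._* ℚ.1/ D) (trans (fromℕ-+ (p A) (a 0 * q A))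
         (cong₂ ℚ._+_ (sym (q*convergent (λ i → a (suc i)) k)) (fromℕ-* (a 0) (q A)))) ⟩
  (fromℕ (q A) ℚ.* c ℚ.+ fromℕ (a 0) ℚ.* fromℕ (q A)) ℚ.* ℚ.1/ D
    ≡⟨ eq (fromℕ (q A)) c (fromℕ (a 0)) (ℚ.1/ D) ⟩
  fromℕ (q A) ℚ.* (D ℚ.* ℚ.1/ D)
    ≡⟨ cong (fromℕ (q A) ℚ.*_) (ℚ.*-inverseʳ D) ⟩
  fromℕ (q A) ℚ.* ℚ.1ℚ
    ≡⟨ ℚ.*-identityʳ (fromℕ (q A)) ⟩
  fromℕ (q A) ∎)
  where
  open ≡-Reasoning
  A = conv (λ i → a (suc i)) k
  c = convergent (λ i → a (suc i)) k
  D = fromℕ (a 0) ℚ.+ c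
  eq : ∀ q c b i → (q ℚ.* c ℚ.+ b ℚ.* q) ℚ.* i ≡ q ℚ.* ((b ℚ.+ c) ℚ.* i)
  eq = S.solve 4 (λ q c b i → (q S.:* c S.:+ b S.:* q) S.:* i S.:= q S.:* ((b S.:+ c) S.:* i)) refl
  instance
    D≢0 : ℚ.NonZero D
    D≢0 = ℚ.pos⇒nonZero D {{denominator-pos a k}}

q*↥≡p*↧ : ∀ q p c → fromℕ q ℚ.* c ≡ fromℕ p → + q ℤ.* ℚ.↥ c ≡ + p ℤ.* ℚ.↧ c
q*↥≡p*↧ q p c@record{} e with ℚᵘ.≃-trans (ℚᵘ.≃-sym (ℚᵘ.≃-trans (ℚ.toℚᵘ-homo-* (fromℕ q) c) (ℚᵘ.*-congʳ {ℚ.toℚᵘ c} (toℚᵘ-/ (+ q) 1))))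
                          (ℚᵘ.≃-trans (ℚᵘ.≃-reflexive (cong ℚ.toℚᵘ e)) (toℚᵘ-/ (+ p) 1))
... | ℚᵘ.*≡* h = trans (sym (ℤ.*-identityʳ _)) (trans h (cong (λ d → + p ℤ.* + d) (*-identityˡ (ℚ.↧ₙ c))))

-- With q · numerator = p · denominator, the determinant times the reduced denominator becomes a
-- multiple of `q`. As the determinant is ±1, `q` divides the reduced denominator.
q≤convergentDenominator : ∀ a .{{_ : ∀ {k} → NonZero (a k)}} m → q (conv a m) ≤ convergentDenominator a m
q≤convergentDenominator a m = ℕ.∣⇒≤ (ℤ.∣⇒∣ᵤ (∣i∣≡1⇒∣ (det A) (∣det-conv∣≡1 a m)
  (ℤ.divides (+ p⁻ A ℤ.* ℚ.↧ c ℤ.- + q⁻ A ℤ.* ℚ.↥ c) (begin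
  (+ p⁻ A ℤ.* + q A ℤ.- + p A ℤ.* + q⁻ A) ℤ.* ℚ.↧ c
    ≡⟨ e₁ (+ p⁻ A) (+ q A) (+ p A) (+ q⁻ A) (ℚ.↧ c) ⟩
  + p⁻ A ℤ.* + q A ℤ.* ℚ.↧ c ℤ.- + q⁻ A ℤ.* (+ p A ℤ.* ℚ.↧ c)
    ≡⟨ cong (λ t → + p⁻ A ℤ.* + q A ℤ.* ℚ.↧ c ℤ.- + q⁻ A ℤ.* t) (q*↥≡p*↧ (q A) (p A) c (q*convergent a m)) ⟨
  + p⁻ A ℤ.* + q A ℤ.* ℚ.↧ c ℤ.- + q⁻ A ℤ.* (+ q A ℤ.* ℚ.↥ c)
    ≡⟨ e₂ (+ p⁻ A) (+ q A) (+ q⁻ A) (ℚ.↧ c) (ℚ.↥ c) ⟩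
  (+ p⁻ A ℤ.* ℚ.↧ c ℤ.- + q⁻ A ℤ.* ℚ.↥ c) ℤ.* + q A ∎))))
  where
  open ≡-Reasoning
  A = conv a m
  c = convergent a m
  e₁ : ∀ p⁻ q p q⁻ d → (p⁻ ℤ.* q ℤ.- p ℤ.* q⁻) ℤ.* d ≡ p⁻ ℤ.* q ℤ.* d ℤ.- q⁻ ℤ.* (p ℤ.* d)
  e₁ = ℤ.solve-∀
  e₂ : ∀ p⁻ q q⁻ d n → p⁻ ℤ.* q ℤ.* d ℤ.- q⁻ ℤ.* (q ℤ.* n) ≡ (p⁻ ℤ.* d ℤ.- q⁻ ℤ.* n) ℤ.* q
  e₂ = ℤ.solve-∀

-- Lower and upper bounds for the Lagrange constants

‖‖ℚ-nonNeg : ∀ x → 0ℚ ℚ.≤ ‖ x ‖ℚ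
‖‖ℚ-nonNeg x with ‖‖-attained x
... | i , e = subst (0ℚ ℚ.≤_) (sym e) (ℚ.0≤∣p∣ (x ℚ.- i / 1))

-- In terms of cuts this says that the constant is at least 0. One term of the first tail suffices:
-- it is nonnegative and lies strictly below `r`.
lagrangeConstant>0 : ∀ β {r} → Above (lagrangeConstant β) r → 0ℚ ℚ.< r
lagrangeConstant>0 β (s , s<r , h) with h 0
... | k , s′ , s′<s , L , bound = ℚ.≤-<-trans
  (ℚ.≤-trans 0≤ (bound L ≤-refl)) (ℚ.<-trans s′<s s<r)
  where
  x = seq (suc k · β) L
  0≤ : 0ℚ ℚ.≤ fromℕ (suc k) ℚ.* ‖ x ‖ℚ
  0≤ = subst (ℚ._≤ fromℕ (suc k) ℚ.* ‖ x ‖ℚ) (ℚ.*-zeroʳ (fromℕ (suc k)))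
    (ℚ.*-monoˡ-≤-nonNeg (fromℕ (suc k)) {{fromℕ-nonNeg (suc k)}} (‖‖ℚ-nonNeg x))

-- The integer `t` bounds the distance to the nearest one. Multiplying by `n * q` clears
-- denominators, since `q` times the difference `v` is the integer `z`.
‖‖-bound : ∀ {C s n p q} c t .{{_ : NonZero n}} → 1 ≤ q → fromℕ q ℚ.* c ≡ fromℕ p →
  s * ℤ.∣ + (s * n) ℤ.* + p ℤ.- t ℤ.* + q ∣ * n ≤ C * q →
  fromℕ s ℚ.* ‖ fromℕ s ℚ.* (fromℕ n ℚ.* c) ‖ℚ ℚ.≤ + C / n
‖‖-bound {C} {s} {n} {p} {q} c t q>0 qc≡p h = ℚ.*-cancelʳ-≤-pos (fromℕ (n * q)) {{fromℕ-pos (n * q) {{m*n≢0 n q}}}} (begin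
  fromℕ s ℚ.* ‖ x ‖ℚ ℚ.* fromℕ (n * q)
    ≤⟨ ℚ.*-monoʳ-≤-nonNeg (fromℕ (n * q)) {{fromℕ-nonNeg (n * q)}}
         (ℚ.*-monoˡ-≤-nonNeg (fromℕ s) {{fromℕ-nonNeg s}} (‖‖-least x t)) ⟩
  fromℕ s ℚ.* ℚ.∣ v ∣ ℚ.* fromℕ (n * q)
    ≡⟨ cong (fromℕ s ℚ.* ℚ.∣ v ∣ ℚ.*_) (fromℕ-* n q) ⟩
  fromℕ s ℚ.* ℚ.∣ v ∣ ℚ.* (fromℕ n ℚ.* fromℕ q)
    ≡⟨ e₁ (fromℕ s) ℚ.∣ v ∣ (fromℕ n) (fromℕ q) ⟩
  fromℕ s ℚ.* (fromℕ q ℚ.* ℚ.∣ v ∣) ℚ.* fromℕ n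
    ≡⟨ cong (λ u → fromℕ s ℚ.* u ℚ.* fromℕ n) q∣v∣≡∣z∣ ⟩
  fromℕ s ℚ.* fromℕ ℤ.∣ z ∣ ℚ.* fromℕ n
    ≡⟨ trans (fromℕ-* (s * ℤ.∣ z ∣) n) (cong (ℚ._* fromℕ n) (fromℕ-* s ℤ.∣ z ∣)) ⟨
  fromℕ (s * ℤ.∣ z ∣ * n)
    ≤⟨ fromℕ-mono h ⟩
  fromℕ (C * q)
    ≡⟨ trans (fromℕ-* C q) (cong (ℚ._* fromℕ q) (sym (/-cancel C n))) ⟩
  + C / n ℚ.* fromℕ n ℚ.* fromℕ q
    ≡⟨ trans (ℚ.*-assoc (+ C / n) (fromℕ n) (fromℕ q)) (cong (+ C / n ℚ.*_) (sym (fromℕ-* n q))) ⟩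
  + C / n ℚ.* fromℕ (n * q) ∎)
  where
  open ℚ.≤-Reasoning
  instance
    q≢0 : NonZero q
    q≢0 = ℕ.>-nonZero q>0
  x = fromℕ s ℚ.* (fromℕ n ℚ.* c)
  v = x ℚ.- t / 1
  z = + (s * n) ℤ.* + p ℤ.- t ℤ.* + q
  e₁ : ∀ s v n q → s ℚ.* v ℚ.* (n ℚ.* q) ≡ s ℚ.* (q ℚ.* v) ℚ.* n
  e₁ = S.solve 4 (λ s v n q → s S.:* v S.:* (n S.:* q) S.:= s S.:* (q S.:* v) S.:* n) refl
  e₂ : ∀ q s n c t → q ℚ.* (s ℚ.* (n ℚ.* c) ℚ.- t) ≡ s ℚ.* n ℚ.* (q ℚ.* c) ℚ.- t ℚ.* q
  e₂ = S.solve 5 (λ q s n c t →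
    q S.:* (s S.:* (n S.:* c) S.:- t) S.:= s S.:* n S.:* (q S.:* c) S.:- t S.:* q) refl
  qv≡z : fromℕ q ℚ.* v ≡ z / 1
  qv≡z = begin-equality
    fromℕ q ℚ.* (fromℕ s ℚ.* (fromℕ n ℚ.* c) ℚ.- t / 1)
      ≡⟨ e₂ (fromℕ q) (fromℕ s) (fromℕ n) c (t / 1) ⟩
    fromℕ s ℚ.* fromℕ n ℚ.* (fromℕ q ℚ.* c) ℚ.- (t / 1) ℚ.* fromℕ q
      ≡⟨ cong₂ (λ u w → u ℚ.- w) (cong₂ ℚ._*_ (fromℕ-* s n) (sym qc≡p)) (/1-* t (+ q)) ⟨
    fromℕ (s * n) ℚ.* fromℕ p ℚ.- (t ℤ.* + q) / 1
      ≡⟨ cong₂ ℚ._+_ (/1-* (+ (s * n)) (+ p)) (/1-neg (t ℤ.* + q)) ⟨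
    (+ (s * n) ℤ.* + p) / 1 ℚ.+ (ℤ.- (t ℤ.* + q)) / 1
      ≡⟨ /1-+ (+ (s * n) ℤ.* + p) (ℤ.- (t ℤ.* + q)) ⟨
    z / 1 ∎
  q∣v∣≡∣z∣ : fromℕ q ℚ.* ℚ.∣ v ∣ ≡ fromℕ ℤ.∣ z ∣
  q∣v∣≡∣z∣ = begin-equality
    fromℕ q ℚ.* ℚ.∣ v ∣          ≡⟨ cong (ℚ._* ℚ.∣ v ∣) (/1-abs (+ q)) ⟩
    ℚ.∣ fromℕ q ∣ ℚ.* ℚ.∣ v ∣    ≡⟨ ℚ.∣p*q∣≡∣p∣*∣q∣ (fromℕ q) v ⟨
    ℚ.∣ fromℕ q ℚ.* v ∣          ≡⟨ cong ℚ.∣_∣ qv≡z ⟩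
    ℚ.∣ z / 1 ∣                  ≡⟨ /1-abs z ⟨
    fromℕ ℤ.∣ z ∣                ∎

lagrangeConstant≤ : ∀ a .{{_ : ∀ {k} → NonZero (a k)}} m → Recurrent (λ i → a (m + i)) → ∀ n .{{_ : NonZero n}} →
  lagrangeConstant (n · continuedFraction a) ≤ᵘ fromℚ (+ (8 * convergentDenominator a m ^ 2) / n)
lagrangeConstant≤ a m recurrent n C/n<r =
  -- `sup` asks for one value strictly below `r` that serves every tail, and `fromℝ` for a further
  -- value strictly below that one; these are `s` and C/n.
  let s , C/n<s , s<r = ℚ.<-dense C/n<r in s , s<r , λ N → above C/n<s N (goodMultiples a>0 m recurrent n N)
  where
  a>0 : ∀ k → 1 ≤ a k
  a>0 k = 1ℕ≤ (a k)
  C = 8 * convergentDenominator a m ^ 2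
  -- The construction yields the constant 2, which 8 absorbs; `^ 2` unfolds to a product ending in
  -- `* 1`.
  2q²≤C : 2 * (q (conv a m) * q (conv a m)) ≤ C
  2q²≤C = *-mono-≤ {2} {8} (s≤s (s≤s z≤n)) (≤-trans (*-mono-≤ q≤ q≤)
    (≤-reflexive (cong (convergentDenominator a m *_) (sym (*-identityʳ _)))))
    where q≤ = q≤convergentDenominator a m
  above : ∀ {s} → + C / n ℚ.< s → ∀ N →
    (∃[ k ] GoodMultiple a n (2 * (q (conv a m) * q (conv a m))) (suc (N + k))) →
    ∃[ k ] Above (fromℝ (suc (N + k) · ‖ suc (N + k) · n · continuedFraction a ‖)) s
  above C/n<s N (k , L , good) = k , + C / n , C/n<s , L , λ j L≤j →
    let t , h = good j L≤j in
    ‖‖-bound {C} {suc (N + k)} {n} {p (conv a j)} {q (conv a j)} (convergent a j) t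
      (Growth.q>0 a>0 j) (q*convergent a j) (≤-trans h (*-monoˡ-≤ (q (conv a j)) 2q²≤C))

/-eventually≤ : ∀ c {ε} → 0ℚ ℚ.< ε → ∃[ N ] (∀ n .{{_ : NonZero n}} → N ≤ n → + c / n ℚ.≤ ε)
/-eventually≤ c {ε} 0<ε with archimedean 0<ε
-- From 1 < Nε and n ≥ cN follows c ≤ cNε ≤ nε.
... | N , 1<Nε = c * N , λ n cN≤n → ℚ.*-cancelʳ-≤-pos (fromℕ n) {{fromℕ-pos n}} (begin
  + c / n ℚ.* fromℕ n            ≡⟨ /-cancel c n ⟩
  fromℕ c                        ≡⟨ ℚ.*-identityʳ (fromℕ c) ⟨
  fromℕ c ℚ.* ℚ.1ℚ               ≤⟨ ℚ.*-monoˡ-≤-nonNeg (fromℕ c) {{fromℕ-nonNeg c}} (ℚ.<⇒≤ 1<Nε) ⟩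
  fromℕ c ℚ.* (fromℕ N ℚ.* ε)    ≡⟨ ℚ.*-assoc (fromℕ c) (fromℕ N) ε ⟨
  fromℕ c ℚ.* fromℕ N ℚ.* ε      ≡⟨ cong (ℚ._* ε) (fromℕ-* c N) ⟨
  fromℕ (c * N) ℚ.* ε            ≤⟨ ℚ.*-monoʳ-≤-nonNeg ε {{ℚ.nonNegative (ℚ.<⇒≤ 0<ε)}} (fromℕ-mono cN≤n) ⟩
  fromℕ n ℚ.* ε                  ≡⟨ ℚ.*-comm (fromℕ n) ε ⟩
  ε ℚ.* fromℕ n                  ∎)
  where open ℚ.≤-Reasoning

theorem3p3 : (a : ℕ → ℕ) .{{_ : ∀ {k} → NonZero (a k)}} (m : ℕ) →
    Recurrent (λ i → a (m + i)) →
    (λ n → lagrangeConstant (n · continuedFraction a)) ⟶ 0ℚ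
    × (∀ n .{{_ : NonZero n}} →
         lagrangeConstant (n · continuedFraction a)
           ≤ᵘ fromℚ (+ (8 * convergentDenominator a m ^ 2) / n))
theorem3p3 a m recurrent = limit , lagrangeConstant≤ a m recurrent
  where
  c : ℕ → ℝᵘ
  c n = lagrangeConstant (n · continuedFraction a)
  C = 8 * convergentDenominator a m ^ 2
  close : ∀ {ε} → 0ℚ ℚ.< ε → ∀ n .{{_ : NonZero n}} → + C / n ℚ.≤ ε →
          fromℚ (0ℚ ℚ.- ε) ≤ᵘ c n × c n ≤ᵘ fromℚ (0ℚ ℚ.+ ε)
  close {ε} 0<ε n C/n≤ε =
    -- The lower half of the limit: - ε < 0 < r for every `r` above the constant.
    (λ above → ℚ.<-trans (subst (ℚ._< 0ℚ) (sym (ℚ.+-identityˡ (ℚ.- ε))) (ℚ.neg-antimono-< 0<ε))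
                         (lagrangeConstant>0 (n · continuedFraction a) above)) ,
    (λ {r} ε<r → lagrangeConstant≤ a m recurrent n
      (ℚ.≤-<-trans C/n≤ε (subst (ℚ._< r) (ℚ.+-identityˡ ε) ε<r)))
  limit : c ⟶ 0ℚ
  -- Starting at `suc N` makes every `n` a successor, so that C/n is defined.
  limit ε 0<ε = let N , C/n≤ε = /-eventually≤ C 0<ε in suc N , λ where
    n@(suc _) N<n → close 0<ε n (C/n≤ε n (<⇒≤ N<n))
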